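{- Let $G$ be a graph of order $n$. Then $\lambda^-(G)=n-1$ if and only if $G$ consists of (i.e. is the disjoint union of) a (possibly empty) two-set perfectly orderable graph and an isolated vertex. Also, $\lambda^-(G)\le n-1$ for every graph $G$.
   Context: Graphs are finite, simple (no loops or multiple edges), undirected; $n=|V(G)|$ is the order of $G$ (at least 1). Skew zero forcing: a subset $S\subseteq V(G)$ (possibly empty) is colored blue and all other vertices white. Skew color change rule: if any vertex (blue or white) has exactly one white neighbor, then that white neighbor becomes blue. $S$ is a skew zero forcing set if repeated application of the rule eventually turns all vertices blue. The skew zero forcing span $\lambda^-(G)$ is the number of distinct cardinalities $k$ for which there exist $Z,F\subseteq V(G)$ with $|Z|=|F|=k$ such that $Z$ is a skew zero forcing set and $F$ is not a skew zero forcing set. A graph $G$ is two-set perfectly orderable if (1) $V(G)$ can be partitioned into ordered sets $U=\{u_1,\ldots,u_m\}$ and $W=\{w_1,\ldots,w_m\}$ such that $u_i v\in E(G)$ only if $v=w_j$ for some $j\le i$, and (2) $u_iw_i\in E(G)$ for all $i\in\{1,\ldots,m\}$. "Possibly empty" means the graph with no vertices is allowed here. -}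

module Defs where

open import Data.Bool.Properties using () renaming (_≟_ to _≟ᵇ_)
open import Data.Empty using (⊥)
open import Data.Fin.Base using (Fin; splitAt; _≤_)
open import Data.Fin.Properties using (_≟_; any?; all?)
open import Data.Fin.Subset using (Subset; ⊤; ⁅_⁆; _∪_; _∉_; _⊃_; ∣_∣)
open import Data.Fin.Subset.Induction using (⊃-wellFounded)
open import Data.Fin.Subset.Properties
  using (_∈?_; anySubset?; x∈⁅x⁆; p⊆p∪q; q⊆p∪q)
open import Data.List.Base using (length; filter; upTo)
open import Data.Nat.Base using (ℕ; suc; _+_)
import Data.Nat.Properties as ℕ
open import Data.Product.Base using (_×_; _,_; ∃-syntax)
open import Data.Sum.Base using (_⊎_; inj₁; inj₂; [_,_])
open import Data.Vec.Properties using (≡-dec)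
open import Function.Base using (_on_)
open import Function.Bundles using (_⤖_; _⇔_; module Bijection)
open import Function.Definitions using (Bijective)
open import Induction.WellFounded using (Acc; acc)
open import Level using (0ℓ)
open import Relation.Binary.Core using (Rel)
open import Relation.Binary.Definitions using (Symmetric; Irreflexive; Decidable)
open import Relation.Binary.Construct.Closure.ReflexiveTransitive using (Star; ε; _◅_)
open import Relation.Binary.PropositionalEquality using (_≡_; refl)
open import Relation.Nullary using (¬_; Dec; yes; no; contradiction)
open import Relation.Nullary.Decidable using (map′; ¬?; _×-dec_; _→-dec_)
import Relation.Unary as U

record Graph (n : ℕ) : Set₁ where
  field
    Adj    : Rel (Fin n) 0ℓ
    adj?   : Decidable Adj
    sym    : Symmetric Adj
    irrefl : Irreflexive _≡_ Adj

open Graph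

private
  variable
    m n : ℕ

record _≅_ (G : Graph m) (H : Graph n) : Set where
  field
    vertices : Fin m ⤖ Fin n
  open Bijection vertices using (to)
  field
    edges : ∀ x y → Adj G x y ⇔ Adj H (to x) (to y)

infix 4 _≅_

module _ (G : Graph m) (H : Graph n) where

  ⊎-Adj : Rel (Fin m ⊎ Fin n) 0ℓ
  ⊎-Adj (inj₁ x) (inj₁ y) = Adj G x y
  ⊎-Adj (inj₁ x) (inj₂ y) = ⊥
  ⊎-Adj (inj₂ x) (inj₁ y) = ⊥
  ⊎-Adj (inj₂ x) (inj₂ y) = Adj H x y

  ⊎-adj? : Decidable ⊎-Adj
  ⊎-adj? (inj₁ x) (inj₁ y) = adj? G x y
  ⊎-adj? (inj₁ x) (inj₂ y) = no λ ()
  ⊎-adj? (inj₂ x) (inj₁ y) = no λ ()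
  ⊎-adj? (inj₂ x) (inj₂ y) = adj? H x y

  ⊎-sym : Symmetric ⊎-Adj
  ⊎-sym {inj₁ x} {inj₁ y} = sym G
  ⊎-sym {inj₂ x} {inj₂ y} = sym H

  ⊎-irrefl : Irreflexive _≡_ ⊎-Adj
  ⊎-irrefl {inj₁ x} refl = irrefl G refl
  ⊎-irrefl {inj₂ x} refl = irrefl H refl

  infixr 6 _⊔_

  _⊔_ : Graph (m + n)
  _⊔_ = record
    { Adj    = ⊎-Adj on splitAt m
    ; adj?   = λ x y → ⊎-adj? (splitAt m x) (splitAt m y)
    ; sym    = λ {x} {y} → ⊎-sym {splitAt m x} {splitAt m y}
    ; irrefl = λ { {x} refl → ⊎-irrefl {splitAt m x} refl }
    }

K₁ : Graph 1
K₁ = record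
  { Adj    = λ _ _ → ⊥
  ; adj?   = λ _ _ → no λ ()
  ; sym    = λ ()
  ; irrefl = λ _ ()
  }

-- Below, a subset S is the set of blue vertices.

module _ (G : Graph n) where

  WhiteNeighbour : Subset n → Fin n → Fin n → Set
  WhiteNeighbour S u v = Adj G u v × v ∉ S

  OnlyWhiteNeighbour : Subset n → Fin n → Fin n → Set
  OnlyWhiteNeighbour S u v =
    WhiteNeighbour S u v × (∀ w → WhiteNeighbour S u w → w ≡ v)

  -- The forcing vertex u may itself be blue or white.
  data Step (S : Subset n) : Subset n → Set where
    force : ∀ u v → OnlyWhiteNeighbour S u v → Step S (S ∪ ⁅ v ⁆)

  SkewZeroForcing : Subset n → Set
  SkewZeroForcing S = Star Step S ⊤

  onlyWhiteNeighbour? : ∀ S u v → Dec (OnlyWhiteNeighbour S u v)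
  onlyWhiteNeighbour? S u v =
    white? v ×-dec all? λ w → white? w →-dec (w ≟ v)
    where
    white? : ∀ w → Dec (WhiteNeighbour S u w)
    white? w = adj? G u w ×-dec ¬? (w ∈? S)

  private
    FirstForce : Subset n → Fin n → Fin n → Set
    FirstForce S u v = OnlyWhiteNeighbour S u v × SkewZeroForcing (S ∪ ⁅ v ⁆)

    grows : ∀ {S u v} → OnlyWhiteNeighbour S u v → (S ∪ ⁅ v ⁆) ⊃ S
    grows {S} {_} {v} ((_ , v∉S) , _) =
      p⊆p∪q ⁅ v ⁆ , v , q⊆p∪q S ⁅ v ⁆ (x∈⁅x⁆ v) , v∉S

    decide : ∀ S → Acc _⊃_ S → Dec (SkewZeroForcing S)
    decide S (acc rec) with ≡-dec _≟ᵇ_ S ⊤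
    ... | yes refl = yes ε
    ... | no S≢⊤   = map′ prepend uncons (any? λ u → any? λ v → firstForce? u v)
      where
      firstForce? : ∀ u v → Dec (FirstForce S u v)
      firstForce? u v with onlyWhiteNeighbour? S u v
      ... | no ¬f = no λ (f , _) → ¬f f
      ... | yes f = map′ (f ,_) (λ (_ , r) → r) (decide (S ∪ ⁅ v ⁆) (rec (grows f)))

      prepend : (∃[ u ] ∃[ v ] FirstForce S u v) → SkewZeroForcing S
      prepend (u , v , f , r) = force u v f ◅ r

      uncons : SkewZeroForcing S → ∃[ u ] ∃[ v ] FirstForce S u v
      uncons ε = contradiction refl S≢⊤
      uncons (force u v f ◅ r) = u , v , f , r

  skewZeroForcing? : U.Decidable SkewZeroForcing
  skewZeroForcing? S = decide S (⊃-wellFounded S)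

  SpanCardinality : ℕ → Set
  SpanCardinality k =
      (∃[ Z ] ∣ Z ∣ ≡ k × SkewZeroForcing Z)
    × (∃[ F ] ∣ F ∣ ≡ k × ¬ SkewZeroForcing F)

  spanCardinality? : U.Decidable SpanCardinality
  spanCardinality? k =
          anySubset? (λ Z → (∣ Z ∣ ℕ.≟ k) ×-dec skewZeroForcing? Z)
    ×-dec anySubset? (λ F → (∣ F ∣ ℕ.≟ k) ×-dec ¬? (skewZeroForcing? F))

  -- Subsets of an n-element set have cardinality at most n, so it is enough
  -- to count among 0, …, n.
  λ⁻ : ℕ
  λ⁻ = length (filter spanCardinality? (upTo (suc n)))

-- Bijectivity of [ u , w ] says that U = {u i} and W = {w i} partition the
-- vertex set and are listed without repetition.  The case half = 0 is the
-- graph with no vertices.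
record TwoSetPerfectlyOrderable (G : Graph n) : Set where
  field
    half      : ℕ
    u w       : Fin half → Fin n
    partition : Bijective _≡_ _≡_ [ u , w ]
    ordered   : ∀ i v → Adj G (u i) v → ∃[ j ] j ≤ i × v ≡ w j
    matched   : ∀ i → Adj G (u i) (w i)

{-# OPTIONS --safe #-}

-- No set of size 0 or n counts for the span, as there is only one of each; hence
-- λ⁻ ≤ n − 1, with equality iff each of 1, …, n − 1 counts.  A failed set of size
-- n − 1 exists iff the vertex v it misses is isolated, and then the only
-- possible forcing set of size 1 is {v}, which forces iff ∅ forces G − v.
--
-- Suppose ∅ forces a graph; let f y be the vertex that forces y, and t y the time
-- at which this happens.  All neighbours z of f y satisfy t z ≤ t y.  In particular
-- t (f (f y)) ≤ t y, so f ∘ f, being injective and never increasing time, is the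
-- identity, and the pairs {y , f y} form a perfect matching.  The later member of each
-- pair goes to U and the earlier one to W, both listed by the time of the W-member.
-- Conversely, in a two-set perfectly orderable graph u₁, u₂, … force w₁, w₂, …,
-- after which w_m, …, w₁ force u_m, …, u₁.
module Submission where

open import Defs
open import Data.Empty using (⊥-elim)
open import Data.Fin.Base as Fin using (Fin; zero; suc; splitAt; join; punchIn; punchOut; _↑ˡ_; _↑ʳ_)
open import Data.Fin.Induction using (<-wellFounded; >-wellFounded)
open import Data.Fin.Properties using
  (_≟_; any?; toℕ-injective; splitAt-↑ˡ; splitAt-↑ʳ; splitAt⁻¹-↑ˡ; splitAt-join; ↑ˡ-injective; +↔⊎;
   punchIn-injective; punchInᵢ≢i; punchIn-punchOut; punchOut-punchIn)
import Data.Fin.Properties as Finₚ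
open import Data.Fin.Subset using (Subset; inside; outside; ⊤; ⊥; ⁅_⁆; ∁; _∪_; _∈_; _∉_; _⊆_; _⊃_; ∣_∣)
open import Data.Fin.Subset.Induction using (⊃-wellFounded)
open import Data.Fin.Subset.Properties using
  (_∈?_; ∈⊤; ⊆⊤; ∉⊥; ⊆-antisym; ∣⊥∣≡0; ∣p∣≡n⇒p≡⊤; ∣∁p∣≡n∸∣p∣; x∉p⇒x∈∁p;
   x∈⁅x⁆; x∈⁅y⁆⇒x≡y; x∈p∪q⁻; p⊆p∪q; q⊆p∪q)
open import Data.List.Base as List using (List; _∷_; _++_; []; allFin; applyUpTo; upTo; filter; length; lookup)
open import Data.List.Membership.Propositional.Properties using (∈-allFin; ∈-filter⁺; ∈-filter⁻; ∈-lookup)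
open import Data.List.Properties using
  (applyUpTo-∷ʳ; filter-all; filter-complete; filter-reject; filter-++; length-applyUpTo;
   length-filter; ++-identityʳ)
open import Data.List.Relation.Binary.Permutation.Propositional using (↭⇒↭ₛ; ↭-sym)
open import Data.List.Relation.Binary.Permutation.Propositional.Properties using (∈-resp-↭)
import Data.List.Relation.Binary.Permutation.Setoid.Properties as Permutationₛ
open import Data.List.Relation.Unary.All as All using (All; []; _∷_)
import Data.List.Relation.Unary.All.Properties as All
open import Data.List.Relation.Unary.Any using (index)
open import Data.List.Relation.Unary.Any.Properties using (lookup-index)
open import Data.List.Relation.Unary.AllPairs using (_∷_)
open import Data.List.Relation.Unary.Sorted.TotalOrder.Properties using (lookup-mono-≤)
open import Data.List.Relation.Unary.Unique.Propositional using (Unique)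
import Data.List.Relation.Unary.Unique.Propositional.Properties as Unique
import Data.List.Sort
open import Data.Nat.Base using (ℕ; zero; suc; NonZero; _≤_; _<_; _+_; _∸_; z≤n; s≤s; z<s)
open import Data.Nat.Properties using
  (≤-refl; ≤-trans; ≤-reflexive; <-irrefl; <-asym; <-≤-trans; ≤-<-trans; ≤-antisym; <⇒≤; ≰⇒>;
   m+n∸n≡m; suc-injective; ≤-decTotalOrder; <-cmp; _<?_; m≤n⇒m<n∨m≡n)
import Data.Nat.Induction as ℕ
open import Data.Product.Base using (_×_; _,_; ∃-syntax; Σ-syntax; proj₁; proj₂)
open import Data.Sum.Base using (_⊎_; inj₁; inj₂; [_,_])
open import Data.Vec.Base using ([]; _∷_; insertAt)
open import Data.Vec.Properties using (insertAt-lookup; lookup⇒[]=; []=⇒lookup)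
open import Function.Base using (_∘_; _on_; case_of_)
open import Function.Bundles using (_⇔_; mk⇔; mk↔ₛ′; module Bijection; module Equivalence)
open import Function.Construct.Composition using (_↔-∘_)
open import Function.Construct.Symmetry using (↔-sym)
open import Function.Definitions using (Injective)
open import Function.Properties.Inverse using (↔⇒⤖)
open import Induction.WellFounded using (Acc; acc)
open import Relation.Binary.Bundles using (DecTotalOrder)
import Relation.Binary.Construct.On as On
open import Relation.Binary.Construct.Closure.ReflexiveTransitive using (ε; _◅_)
open import Relation.Binary.Definitions using (tri<; tri≈; tri>)
open import Relation.Binary.PropositionalEquality
  using (_≡_; _≢_; refl; sym; trans; cong; subst; setoid)
open import Relation.Nullary using (¬_; yes; no; contradiction)
open import Relation.Nullary.Decidable using (decidable-stable)
import Relation.Unary as U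

open Graph using (Adj; adj?; irrefl)

private
  variable
    m n k : ℕ

-- Subsets and their cardinalities.

∁-involutive : ∀ (p : Subset n) → ∁ (∁ p) ≡ p
∁-involutive []            = refl
∁-involutive (inside  ∷ p) = cong (inside  ∷_) (∁-involutive p)
∁-involutive (outside ∷ p) = cong (outside ∷_) (∁-involutive p)

∣p∣≡0⇒p≡⊥ : ∀ {p : Subset n} → ∣ p ∣ ≡ 0 → p ≡ ⊥
∣p∣≡0⇒p≡⊥ {p = []}          _ = refl
∣p∣≡0⇒p≡⊥ {p = outside ∷ p} e = cong (outside ∷_) (∣p∣≡0⇒p≡⊥ e)

∣p∣≡1⇒p≡⁅x⁆ : ∀ {p : Subset n} → ∣ p ∣ ≡ 1 → ∃[ x ] p ≡ ⁅ x ⁆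
∣p∣≡1⇒p≡⁅x⁆ {p = outside ∷ p} e = let x , p≡ = ∣p∣≡1⇒p≡⁅x⁆ e in suc x , cong (outside ∷_) p≡
∣p∣≡1⇒p≡⁅x⁆ {p = inside ∷ p}  e = zero , cong (inside ∷_) (∣p∣≡0⇒p≡⊥ (suc-injective e))

subsetOfSize : k ≤ n → ∃[ p ] ∣_∣ {n} p ≡ k
subsetOfSize {n = n} z≤n = ⊥ , ∣⊥∣≡0 n
subsetOfSize (s≤s k≤n) = let p , e = subsetOfSize k≤n in inside ∷ p , cong suc e

∣insertAt∣ : ∀ (p : Subset n) x b → ∣ insertAt p x b ∣ ≡ ∣ b ∷ p ∣
∣insertAt∣ p             zero    b       = refl
∣insertAt∣ (inside  ∷ p) (suc x) inside  = cong suc (∣insertAt∣ p x inside)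
∣insertAt∣ (outside ∷ p) (suc x) inside  = ∣insertAt∣ p x inside
∣insertAt∣ (inside  ∷ p) (suc x) outside = cong suc (∣insertAt∣ p x outside)
∣insertAt∣ (outside ∷ p) (suc x) outside = ∣insertAt∣ p x outside

∈-insertAt-inside : ∀ (p : Subset n) x → x ∈ insertAt p x inside
∈-insertAt-inside p x = lookup⇒[]= x _ (insertAt-lookup p x inside)

∉-insertAt-outside : ∀ (p : Subset n) x → x ∉ insertAt p x outside
∉-insertAt-outside p x x∈ = case trans (sym ([]=⇒lookup x∈)) (insertAt-lookup p x outside) of λ ()

-- Enumerating vertices in order of time.

lookup-injective : ∀ {A : Set} {xs : List A} → Unique xs → Injective _≡_ _≡_ (lookup xs)
lookup-injective (_ ∷ _)    {zero}  {zero}  _ = refl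
lookup-injective (x∉ ∷ _)   {zero}  {suc j} e = contradiction e (All.lookup x∉ (∈-lookup j))
lookup-injective (x∉ ∷ _)   {suc i} {zero}  e = contradiction (sym e) (All.lookup x∉ (∈-lookup i))
lookup-injective (_ ∷ uniq) {suc i} {suc j} e = cong suc (lookup-injective uniq e)

module _ (t : Fin n → ℕ) {P : Fin n → Set} (P? : U.Decidable P) where

  private
    order : DecTotalOrder _ _ _
    order = On.decTotalOrder ≤-decTotalOrder t

    open Data.List.Sort order

    unsorted : List (Fin n)
    unsorted = filter P? (allFin n)

  -- Sorting only permutes the filtered list, so distinctness and membership carry over. With `t`
  -- the forcing time, this produces the listing of W.
  sortedEnumeration :
    ∃[ h ] Σ[ w ∈ (Fin h → Fin n) ]
      Injective _≡_ _≡_ w × (∀ i → P (w i)) × (∀ x → P x → ∃[ i ] x ≡ w i) ×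
      (∀ {i j} → i Fin.≤ j → t (w i) ≤ t (w j))
  sortedEnumeration =
      length sorted , lookup sorted
    , lookup-injective
        (Permutationₛ.Unique-resp-↭ (setoid _) (↭⇒↭ₛ (↭-sym perm)) (Unique.filter⁺ P? (Unique.allFin⁺ n)))
    , (λ i → proj₂ (∈-filter⁻ P? {xs = allFin n} (∈-resp-↭ perm (∈-lookup i))))
    , (λ x Px → let x∈ = ∈-resp-↭ (↭-sym perm) (∈-filter⁺ P? (∈-allFin x) Px)
                in index x∈ , lookup-index x∈)
    , lookup-mono-≤ (DecTotalOrder.totalOrder order) (sort-↗ unsorted)
    where
    sorted = sort unsorted
    perm = sort-↭ unsorted

-- Chronologies of forcing sequences, and stuck sets.

-- Vertices that are blue from the start get time 0 and an irrelevant forcer.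
record Chronology (G : Graph n) (S : Subset n) : Set where
  field
    time   : Fin n → ℕ
    forcer : Fin n → Fin n
    blue   : ∀ {x} → x ∈ S → time x ≡ 0
    white  : ∀ {x} → x ∉ S → 0 < time x
    time-injective : ∀ {x y} → x ∉ S → y ∉ S → time x ≡ time y → x ≡ y
    forces : ∀ {y} → y ∉ S → Adj G (forcer y) y
    last   : ∀ {y z} → y ∉ S → Adj G (forcer y) z → time z ≤ time y

Isolated : Graph n → Fin n → Set
Isolated G v = ∀ x → ¬ Adj G v x

module _ (G : Graph n) where

  private
    -- Prepending a force delays every later one by a unit. The new vertex `v` was blue at time 0
    -- and so gets time 1, distinct from the later ones, whose times were already positive.
    chronology-◅ : ∀ {S u v} → OnlyWhiteNeighbour G S u v →
                   Chronology G (S ∪ ⁅ v ⁆) → Chronology G S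
    chronology-◅ {S} {u} {v} ((u~v , v∉S) , only) C = record
      { time = time′ ; forcer = forcer′ ; blue = blue′ ; white = white′
      ; time-injective = inj′ ; forces = forces′ ; last = last′ }
      where
      open Chronology C

      v∈ : v ∈ S ∪ ⁅ v ⁆
      v∈ = q⊆p∪q S ⁅ v ⁆ (x∈⁅x⁆ v)

      still-white : ∀ {x} → x ∉ S → x ≢ v → x ∉ S ∪ ⁅ v ⁆
      still-white x∉S x≢v x∈ = [ x∉S , x≢v ∘ x∈⁅y⁆⇒x≡y v ] (x∈p∪q⁻ S ⁅ v ⁆ x∈)

      time′ : Fin n → ℕ
      time′ x with x ∈? S
      ... | yes _ = 0
      ... | no  _ = suc (time x)

      forcer′ : Fin n → Fin n
      forcer′ x with x ≟ v
      ... | yes _ = u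
      ... | no  _ = forcer x

      blue′ : ∀ {x} → x ∈ S → time′ x ≡ 0
      blue′ {x} x∈S with x ∈? S
      ... | yes _  = refl
      ... | no x∉S = contradiction x∈S x∉S

      time′-white : ∀ {x} → x ∉ S → time′ x ≡ suc (time x)
      time′-white {x} x∉S with x ∈? S
      ... | yes x∈S = contradiction x∈S x∉S
      ... | no _    = refl

      time′≤ : ∀ x → time′ x ≤ suc (time x)
      time′≤ x with x ∈? S
      ... | yes _ = z≤n
      ... | no _  = ≤-refl

      white′ : ∀ {x} → x ∉ S → 0 < time′ x
      white′ x∉S rewrite time′-white x∉S = z<s

      inj′ : ∀ {x y} → x ∉ S → y ∉ S → time′ x ≡ time′ y → x ≡ y
      inj′ {x} {y} x∉S y∉S e rewrite time′-white x∉S | time′-white y∉S with x ≟ v | y ≟ v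
      ... | yes refl | yes refl = refl
      ... | yes refl | no y≢v = contradiction (white (still-white y∉S y≢v))
              (<-irrefl (trans (sym (blue v∈)) (suc-injective e)))
      ... | no x≢v | yes refl = contradiction (white (still-white x∉S x≢v))
              (<-irrefl (sym (trans (suc-injective e) (blue v∈))))
      ... | no x≢v | no y≢v = time-injective (still-white x∉S x≢v) (still-white y∉S y≢v) (suc-injective e)

      forces′ : ∀ {y} → y ∉ S → Adj G (forcer′ y) y
      forces′ {y} y∉S with y ≟ v
      ... | yes refl = u~v
      ... | no y≢v   = forces (still-white y∉S y≢v)

      last′ : ∀ {y z} → y ∉ S → Adj G (forcer′ y) z → time′ z ≤ time′ y
      last′ {y} {z} y∉S fy~z rewrite time′-white y∉S with y ≟ v
      -- `z` may lie in `S`, where its time stays 0; hence the inequality `time′≤`.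
      ... | no y≢v = ≤-trans (time′≤ z) (s≤s (last (still-white y∉S y≢v) fy~z))
      ... | yes refl with z ∈? S
      ...   | yes _  = z≤n
      ...   | no z∉S rewrite only z (fy~z , z∉S) = ≤-refl

  chronology : ∀ {S} → SkewZeroForcing G S → Chronology G S
  chronology ε = record
    { time = λ _ → 0 ; forcer = λ x → x ; blue = λ _ → refl ; white = λ x∉ → contradiction ∈⊤ x∉
    ; time-injective = λ x∉ → contradiction ∈⊤ x∉ ; forces = λ y∉ → contradiction ∈⊤ y∉
    ; last = λ y∉ → contradiction ∈⊤ y∉ }
  chronology (force u v only ◅ r) = chronology-◅ only (chronology r)

  -- A vertex that turns blue is adjacent to its forcer.
  isolated-white⇒¬forcing : ∀ {S v} → Isolated G v → v ∉ S → ¬ SkewZeroForcing G S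
  isolated-white⇒¬forcing iso v∉S r =
    iso _ (Graph.sym G (Chronology.forces (chronology r) v∉S))

  Stuck : Subset n → Set
  Stuck S = ∀ u v → ¬ OnlyWhiteNeighbour G S u v

  -- Greedy forcing strictly enlarges the blue set, so it ends at a stuck superset of `S`. Forcing
  -- can thus be proved from properties of stuck sets, without writing down a sequence of forces.
  stuck⊤⇒forcing : ∀ {S} → (∀ T → S ⊆ T → Stuck T → T ≡ ⊤) → SkewZeroForcing G S
  stuck⊤⇒forcing {S} = go S (⊃-wellFounded S)
    where
    go : ∀ S → Acc _⊃_ S → (∀ T → S ⊆ T → Stuck T → T ≡ ⊤) → SkewZeroForcing G S
    go S (acc rec) stuck⇒⊤ with any? (λ u → any? λ v → onlyWhiteNeighbour? G S u v)
    ... | no stuck rewrite stuck⇒⊤ S (λ x∈ → x∈) (λ u v f → stuck (u , v , f)) = ε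
    ... | yes (u , v , f@((_ , v∉S) , _)) = force u v f ◅
          go (S ∪ ⁅ v ⁆) (rec (p⊆p∪q ⁅ v ⁆ , v , q⊆p∪q S ⁅ v ⁆ (x∈⁅x⁆ v) , v∉S))
             (λ T S∪v⊆T → stuck⇒⊤ T (S∪v⊆T ∘ p⊆p∪q ⁅ v ⁆))

-- From forcing by the empty set to a two-set perfect ordering.

module _ {H : Graph n} (C : Chronology H ⊥) where
  open Chronology C

  private
    t-inj : ∀ {x y} → time x ≡ time y → x ≡ y
    t-inj = time-injective ∉⊥ ∉⊥

    matched : ∀ y → Adj H (forcer y) y
    matched y = forces ∉⊥

    before : ∀ {y z} → Adj H (forcer y) z → time z ≤ time y
    before = last ∉⊥

    -- If `y` and `z` share a forcer, each is a neighbour of the other's forcer, so each time bounds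
    -- the other.
    forcer-injective : ∀ {y z} → forcer y ≡ forcer z → y ≡ z
    forcer-injective {y} {z} e = t-inj (≤-antisym
      (before (subst (λ a → Adj H a y) e (matched y)))
      (before (subst (λ a → Adj H a z) (sym e) (matched z))))

    forcer² : ∀ y → forcer (forcer y) ≡ y
    forcer² y = go y (ℕ.<-wellFounded (time y))
      where
      go : ∀ y → Acc _<_ (time y) → forcer (forcer y) ≡ y
      go y (acc rec) with m≤n⇒m<n∨m≡n (before (Graph.sym H (matched (forcer y))))
      -- By induction `forcer (forcer y)` is fixed by applying `forcer` twice; cancelling `forcer`
      -- twice on both sides leaves the claim for `y`.
      ... | inj₁ earlier = forcer-injective (forcer-injective (go (forcer (forcer y)) (rec earlier)))
      ... | inj₂ e       = t-inj e

    -- Since `forcer` is an involution, every `x` is itself a forcer, namely of `forcer x`.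
    before′ : ∀ {x z} → Adj H x z → time z ≤ time (forcer x)
    before′ {x} {z} x~z = before (subst (λ a → Adj H a z) (sym (forcer² x)) x~z)

  chronology⇒2SPO : TwoSetPerfectlyOrderable H
  chronology⇒2SPO
    with h , w , w-inj , first , complete , mono ←
      sortedEnumeration time (λ x → time x <? time (forcer x))
    = record
    { half = h
    ; u = u
    ; w = w
    ; partition = inj , λ x → let y , e = surj x in y , λ { refl → e }
    ; ordered = ordered
    ; matched = λ i → matched (w i)
    }
    where
    u = forcer ∘ w

    -- A common vertex would be both the later and the earlier member of its matched pair.
    disjoint : ∀ i j → u i ≢ w j
    disjoint i j e = <-asym (first i)
      (subst (λ a → time a < time (w i)) (sym e)
        (subst (λ a → time (w j) < time a) (trans (cong forcer (sym e)) (forcer² (w i))) (first j)))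

    inj : Injective _≡_ _≡_ [ u , w ]
    inj {inj₁ i} {inj₁ j} e = cong inj₁ (w-inj (forcer-injective e))
    inj {inj₁ i} {inj₂ j} e = contradiction e (disjoint i j)
    inj {inj₂ i} {inj₁ j} e = contradiction (sym e) (disjoint j i)
    inj {inj₂ i} {inj₂ j} e = cong inj₂ (w-inj e)

    surj : ∀ x → ∃[ y ] [ u , w ] y ≡ x
    surj x with <-cmp (time x) (time (forcer x))
    ... | tri< lt _ _ = let i , e = complete x lt in inj₂ i , sym e
    ... | tri≈ _ e _  = ⊥-elim (irrefl H (sym (t-inj e)) (matched x))
    ... | tri> _ _ gt =
      let i , e = complete (forcer x) (subst (λ a → time (forcer x) < time a) (sym (forcer² x)) gt)
      in inj₁ i , trans (cong forcer (sym e)) (forcer² x)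

    ordered : ∀ i x → Adj H (u i) x → ∃[ j ] j Fin.≤ i × x ≡ w j
    ordered i x ui~x
      with t[x]≤t[wi] ← before ui~x
      -- The times of `x`, `w i`, `u i`, `forcer x` increase in this order, strictly at the middle
      -- step, so `x` is the earlier member of its pair and belongs to W.
      with j , refl ← complete x
        (≤-<-trans t[x]≤t[wi] (<-≤-trans (first i) (before′ (Graph.sym H ui~x))))
      with j Finₚ.≤? i
    ... | yes j≤i = j , j≤i , refl
    -- If `j` came after `i`, sortedness would reverse the time bound and make `w i` and `w j`
    -- equal.
    ... | no  j≰i with refl ← w-inj (t-inj (≤-antisym (mono (<⇒≤ (≰⇒> j≰i))) t[x]≤t[wi])) = ⊥-elim (j≰i ≤-refl)

-- Deleting an isolated vertex.

module _ (G : Graph (suc m)) (v : Fin (suc m)) where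

  delete : Graph m
  delete = record
    { Adj    = Adj G on punchIn v
    ; adj?   = λ x y → adj? G (punchIn v x) (punchIn v y)
    ; sym    = Graph.sym G
    ; irrefl = irrefl G ∘ cong (punchIn v)
    }

  module _ (isolated : Isolated G v) where

    -- An isolated `v` never forces, so all forcers survive the deletion. Having `v` blue at the
    -- start of `G` amounts to starting from the empty set in `delete`.
    delete-chronology : Chronology G ⁅ v ⁆ → Chronology delete ⊥
    delete-chronology C = record
      { time   = time ∘ punchIn v
      ; forcer = λ y → punchOut (v≢forcer y)
      ; blue   = λ x∈ → contradiction x∈ ∉⊥
      ; white  = λ _ → white (white-punchIn _)
      ; time-injective = λ _ _ e → punchIn-injective v _ _ (time-injective (white-punchIn _) (white-punchIn _) e)
      ; forces = λ {y} _ → subst (λ a → Adj G a (punchIn v y)) (sym (punchIn-punchOut (v≢forcer y)))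
                                 (forces (white-punchIn y))
      ; last   = λ {y} {z} _ fy~z → last (white-punchIn y)
                   (subst (λ a → Adj G a (punchIn v z)) (punchIn-punchOut (v≢forcer y)) fy~z)
      }
      where
      open Chronology C

      white-punchIn : ∀ x → punchIn v x ∉ ⁅ v ⁆
      white-punchIn x = punchInᵢ≢i v x ∘ x∈⁅y⁆⇒x≡y v

      v≢forcer : ∀ y → v ≢ forcer (punchIn v y)
      v≢forcer y e = isolated _ (subst (λ a → Adj G a (punchIn v y)) (sym e) (forces (white-punchIn y)))

    private
      split : Fin (suc m) → Fin m ⊎ Fin 1
      split x with v ≟ x
      ... | yes _  = inj₂ zero
      ... | no v≢x = inj₁ (punchOut v≢x)

      unsplit : Fin m ⊎ Fin 1 → Fin (suc m)
      unsplit = [ punchIn v , (λ _ → v) ]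

      split-unsplit : ∀ y → split (unsplit y) ≡ y
      split-unsplit (inj₁ y) with v ≟ punchIn v y
      ... | yes e  = contradiction (sym e) (punchInᵢ≢i v y)
      ... | no v≢ = cong inj₁ (trans (Finₚ.punchOut-cong v refl) (punchOut-punchIn v))
      split-unsplit (inj₂ zero) with v ≟ v
      ... | yes _  = refl
      ... | no v≢v = contradiction refl v≢v

      unsplit-split : ∀ x → unsplit (split x) ≡ x
      unsplit-split x with v ≟ x
      ... | yes e  = e
      ... | no v≢x = punchIn-punchOut v≢x

      split-edges : ∀ x y → Adj G x y ⇔ ⊎-Adj delete K₁ (split x) (split y)
      split-edges x y with v ≟ x | v ≟ y
      ... | yes refl | yes _    = mk⇔ (isolated _) λ ()
      ... | yes refl | no _     = mk⇔ (isolated _) λ ()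
      ... | no _     | yes refl = mk⇔ (isolated _ ∘ Graph.sym G) λ ()
      ... | no v≢x   | no v≢y rewrite punchIn-punchOut v≢x | punchIn-punchOut v≢y = mk⇔ (λ e → e) (λ e → e)

    delete-⊔-K₁ : G ≅ delete ⊔ K₁
    delete-⊔-K₁ = record
      { vertices = ↔⇒⤖ (↔-sym (+↔⊎ {m} {1}) ↔-∘ mk↔ₛ′ split unsplit split-unsplit unsplit-split)
      -- The bijection ends with `join`, which is undone by the `splitAt` inside `_⊔_`.
      ; edges    = λ x y → subst (Adj G x y ⇔_)
          (sym (⊎-Adj-join x y)) (split-edges x y)
      }
      where
      ⊎-Adj-join : ∀ x y → Adj (delete ⊔ K₁) (join m 1 (split x)) (join m 1 (split y))
                         ≡ ⊎-Adj delete K₁ (split x) (split y)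
      ⊎-Adj-join x y rewrite splitAt-join m 1 (split x) | splitAt-join m 1 (split y) = refl

-- Forcing from the isolated vertex of an ordered graph.

-- The structure of `H ⊔ K₁` pulled back along the isomorphism, so that the forcing argument runs on
-- the vertices of `G` itself.
record OrderedPlusIsolated (G : Graph n) : Set where
  field
    {half}   : ℕ
    u w      : Fin half → Fin n
    v        : Fin n
    isolated : Isolated G v
    cover    : ∀ x → (∃[ i ] x ≡ u i) ⊎ (∃[ i ] x ≡ w i) ⊎ x ≡ v
    w-inj    : Injective _≡_ _≡_ w
    ordered  : ∀ i x → Adj G (u i) x → ∃[ j ] j Fin.≤ i × x ≡ w j
    matched  : ∀ i → Adj G (u i) (w i)

module _ {G : Graph n} (O : OrderedPlusIsolated G) where
  open OrderedPlusIsolated O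

  private
    module _ {T : Subset n} (v∈T : v ∈ T) (stuck : Stuck G T) where

      -- Upward induction: the neighbours of `u i` other than `w i` are some `w j` with `j < i`,
      -- already blue, so a white `w i` would be forced by `u i`.
      w∈T : ∀ i → w i ∈ T
      w∈T i = go i (<-wellFounded i)
        where
        go : ∀ i → Acc Fin._<_ i → w i ∈ T
        go i (acc rec) = decidable-stable (w i ∈? T) λ wi∉T →
          stuck (u i) (w i) ((matched i , wi∉T) , λ where
            x (ui~x , x∉T) → case ordered i x ui~x of λ where
              (j , j≤i , refl) → case m≤n⇒m<n∨m≡n j≤i of λ where
                (inj₁ j<i) → contradiction (go j (rec j<i)) x∉T
                (inj₂ e)   → cong w (toℕ-injective e))

      -- Downward induction: with `v` and all of W blue, a white neighbour of `w i` is some `u j`.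
      -- Then `ordered` gives `i ≤ j`, and every `u j` with `j > i` is already blue.
      u∈T : ∀ i → u i ∈ T
      u∈T i = go i (>-wellFounded i)
        where
        go : ∀ i → Acc Fin._>_ i → u i ∈ T
        go i (acc rec) = decidable-stable (u i ∈? T) λ ui∉T →
          stuck (w i) (u i) ((Graph.sym G (matched i) , ui∉T) , λ where
            x (wi~x , x∉T) → case cover x of λ where
              (inj₂ (inj₁ (j , refl))) → contradiction (w∈T j) x∉T
              (inj₂ (inj₂ refl))       → contradiction v∈T x∉T
              (inj₁ (j , refl)) → case ordered j (w i) (Graph.sym G wi~x) of λ where
                (k , k≤j , e) → case m≤n⇒m<n∨m≡n (subst (Fin._≤ j) (sym (w-inj e)) k≤j) of λ where
                  (inj₁ i<j) → contradiction (go j (rec i<j)) x∉T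
                  (inj₂ i≡j) → cong u (sym (toℕ-injective i≡j)))

      stuck⇒⊤ : T ≡ ⊤
      stuck⇒⊤ = ⊆-antisym ⊆⊤ λ {x} _ → case cover x of λ where
        (inj₁ (i , refl))        → u∈T i
        (inj₂ (inj₁ (i , refl))) → w∈T i
        (inj₂ (inj₂ refl))       → v∈T

  isolated∈⇒forcing : ∀ {S} → v ∈ S → SkewZeroForcing G S
  isolated∈⇒forcing v∈S = stuck⊤⇒forcing G λ T S⊆T → stuck⇒⊤ (S⊆T v∈S)

orderedPlusIsolated : ∀ {G : Graph n} {H : Graph m} →
                      TwoSetPerfectlyOrderable H → G ≅ H ⊔ K₁ → OrderedPlusIsolated G
orderedPlusIsolated {n} {m} {G} {H} 2SPO iso = record
  { u        = from ∘ (_↑ˡ 1) ∘ H.u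
  ; w        = from ∘ (_↑ˡ 1) ∘ H.w
  ; v        = from (m ↑ʳ zero)
  ; isolated = isolated
  ; cover    = cover
  ; w-inj    = λ e → inj₂-injective (proj₁ H.partition (↑ˡ-injective 1 _ _ (from-injective e)))
  ; ordered  = ordered
  ; matched  = matched
  }
  where
  module H = TwoSetPerfectlyOrderable 2SPO
  open _≅_ iso
  open Bijection vertices using (to; injective; strictlySurjective)

  from : Fin (m + 1) → Fin n
  from y = proj₁ (strictlySurjective y)

  to-from : ∀ y → to (from y) ≡ y
  to-from y = proj₂ (strictlySurjective y)

  from-injective : ∀ {x y} → from x ≡ from y → x ≡ y
  from-injective e = trans (sym (to-from _)) (trans (cong to e) (to-from _))

  inj₂-injective : ∀ {A B : Set} {x y : B} → inj₂ {A = A} x ≡ inj₂ y → x ≡ y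
  inj₂-injective refl = refl

  from-unique : ∀ {x y} → to x ≡ y → x ≡ from y
  from-unique e = injective (trans e (sym (to-from _)))

  edge-from : ∀ y x → Adj G (from y) x → ⊎-Adj H K₁ (splitAt m y) (splitAt m (to x))
  edge-from y x e = subst (λ a → ⊎-Adj H K₁ (splitAt m a) (splitAt m (to x))) (to-from y)
    (Equivalence.to (edges (from y) x) e)

  isolated : Isolated G (from (m ↑ʳ zero))
  -- The type of `e′` reduces only once the side of `to x` is known: the edge would either cross the
  -- summands or lie in `K₁`.
  isolated x e with e′ ← edge-from _ x e rewrite splitAt-↑ʳ m 1 zero with splitAt m (to x)
  ... | inj₁ _ = e′
  ... | inj₂ _ = e′

  cover : ∀ x → (∃[ i ] x ≡ from (H.u i ↑ˡ 1)) ⊎ (∃[ i ] x ≡ from (H.w i ↑ˡ 1)) ⊎ x ≡ from (m ↑ʳ zero)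
  cover x with splitAt m (to x) in eq
  ... | inj₂ zero = inj₂ (inj₂ (from-unique (sym (Finₚ.splitAt⁻¹-↑ʳ eq))))
  ... | inj₁ y with proj₂ H.partition y
  ...   | inj₁ i , e with refl ← e refl = inj₁ (i , from-unique (sym (splitAt⁻¹-↑ˡ eq)))
  ...   | inj₂ i , e with refl ← e refl = inj₂ (inj₁ (i , from-unique (sym (splitAt⁻¹-↑ˡ eq))))

  ordered : ∀ i x → Adj G (from (H.u i ↑ˡ 1)) x → ∃[ j ] j Fin.≤ i × x ≡ from (H.w j ↑ˡ 1)
  ordered i x e with e′ ← edge-from _ x e rewrite splitAt-↑ˡ m (H.u i) 1 with splitAt m (to x) in eq
  -- In the omitted case `to x` is the vertex of `K₁`, and `e′` would be an edge between the
  -- summands.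
  ... | inj₁ y with j , j≤i , refl ← H.ordered i y e′ = j , j≤i , from-unique (sym (splitAt⁻¹-↑ˡ eq))

  matched : ∀ i → Adj G (from (H.u i ↑ˡ 1)) (from (H.w i ↑ˡ 1))
  matched i = Equivalence.from (edges _ _) edge
    where
    edge : Adj (H ⊔ K₁) (to (from (H.u i ↑ˡ 1))) (to (from (H.w i ↑ˡ 1)))
    edge rewrite to-from (H.u i ↑ˡ 1) | to-from (H.w i ↑ˡ 1)
               | splitAt-↑ˡ m (H.u i) 1 | splitAt-↑ˡ m (H.w i) 1 = H.matched i

-- Counting the cardinalities in the span.

module _ {P : ℕ → Set} (P? : U.Decidable P) (¬P-0 : ¬ P 0) (¬P-n : ¬ P (suc m)) where

  private
    -- The first and last entries, 0 and `suc m`, are rejected; `applyUpTo suc m` lists 1, ..., m.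
    drop-ends : filter P? (upTo (suc (suc m))) ≡ filter P? (applyUpTo suc m)
    drop-ends = trans (filter-reject P? ¬P-0)
      (trans (cong (filter P?) (sym (applyUpTo-∷ʳ suc m)))
      (trans (filter-++ P? (applyUpTo suc m) List.[ suc m ])
      (trans (cong (filter P? (applyUpTo suc m) ++_) (filter-reject P? ¬P-n))
             (++-identityʳ _))))

  count≤ : length (filter P? (upTo (suc (suc m)))) ≤ m
  count≤ rewrite drop-ends =
    ≤-trans (length-filter P? (applyUpTo suc m)) (≤-reflexive (length-applyUpTo suc m))

  -- A filtered list as long as the original has lost no entry.
  count≡⇔all : length (filter P? (upTo (suc (suc m)))) ≡ m ⇔ All P (applyUpTo suc m)
  count≡⇔all rewrite drop-ends = mk⇔
    (λ e → subst (All P) (filter-complete P? (trans e (sym (length-applyUpTo suc m))))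
                 (All.all-filter P? (applyUpTo suc m)))
    (λ all → trans (cong length (filter-all P? all)) (length-applyUpTo suc m))

-- The span of a graph and the two implications.

module _ (G : Graph (suc m)) where

  private
    ¬span-0 : ¬ SpanCardinality G 0
    ¬span-0 ((Z , ∣Z∣≡0 , forcing) , (F , ∣F∣≡0 , failed)) =
      failed (subst (SkewZeroForcing G) (trans (∣p∣≡0⇒p≡⊥ ∣Z∣≡0) (sym (∣p∣≡0⇒p≡⊥ ∣F∣≡0))) forcing)

    ¬span-n : ¬ SpanCardinality G (suc m)
    ¬span-n (_ , (F , ∣F∣≡n , failed)) = failed (subst (SkewZeroForcing G) (sym (∣p∣≡n⇒p≡⊤ ∣F∣≡n)) ε)

  λ⁻≤ : λ⁻ G ≤ m
  λ⁻≤ = count≤ (spanCardinality? G) ¬span-0 ¬span-n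

  λ⁻≡⇔span : λ⁻ G ≡ m ⇔ All (SpanCardinality G) (applyUpTo suc m)
  λ⁻≡⇔span = count≡⇔all (spanCardinality? G) ¬span-0 ¬span-n

  -- A neighbour `x` of `v` would have `v` as its only white neighbour and force it.
  failed-∁⁅v⁆⇒isolated : ∀ {v} → ¬ SkewZeroForcing G (∁ ⁅ v ⁆) → Isolated G v
  failed-∁⁅v⁆⇒isolated {v} failed x v~x = failed (stuck⊤⇒forcing G stuck⇒⊤)
    where
    stuck⇒⊤ : ∀ T → ∁ ⁅ v ⁆ ⊆ T → Stuck G T → T ≡ ⊤
    stuck⇒⊤ T ⊆T stuck = ⊆-antisym ⊆⊤ λ {y} _ → case y ≟ v of λ where
        (yes refl) → decidable-stable (v ∈? T) λ v∉T →
          stuck x v ((Graph.sym G v~x , v∉T) , λ z (_ , z∉T) →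
            decidable-stable (z ≟ v) (z∉T ∘ others))
        (no y≢v)   → others y≢v
      where
      others : ∀ {y} → y ≢ v → y ∈ T
      others y≢v = ⊆T (x∉p⇒x∈∁p (y≢v ∘ x∈⁅y⁆⇒x≡y v))

span⇒isolated-forces : (G : Graph (suc m)) → All (SpanCardinality G) (applyUpTo suc m) →
                           ∃[ v ] Isolated G v × SkewZeroForcing G ⁅ v ⁆
-- For order 1 there is no cardinality to test, but the single vertex is isolated and its singleton
-- is already `⊤`.
span⇒isolated-forces {zero}  G _ = zero , (λ { zero → irrefl G refl }) , ε
span⇒isolated-forces {suc m} G all
  -- Only the extreme cardinalities enter: a forcing singleton `Z`, and a failed set `F` of size
  -- `suc m` in a graph of order `suc (suc m)`, which misses exactly one vertex `v`.
  with (Z , ∣Z∣≡1 , forcing) , _ ← All.applyUpTo⁻ suc (suc m) all z<s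
  with _ , (F , ∣F∣≡ , failed) ← All.applyUpTo⁻ suc (suc m) all ≤-refl
  with z , refl ← ∣p∣≡1⇒p≡⁅x⁆ {p = Z} ∣Z∣≡1
  with v , ∁F≡⁅v⁆ ← ∣p∣≡1⇒p≡⁅x⁆ {p = ∁ F}
         (trans (∣∁p∣≡n∸∣p∣ F) (trans (cong (suc (suc m) ∸_) ∣F∣≡) (m+n∸n≡m 1 (suc m))))
  with refl ← trans (sym (∁-involutive F)) (cong ∁ ∁F≡⁅v⁆)
  with isolated ← failed-∁⁅v⁆⇒isolated G failed
  with v ∈? ⁅ z ⁆
... | no v∉ = contradiction forcing (isolated-white⇒¬forcing G isolated v∉)
... | yes v∈ with refl ← x∈⁅y⁆⇒x≡y z v∈ = v , isolated , forcing

-- For size `suc i`, adding `v` to `i` of the other `m` vertices gives a forcing set, while `suc i`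
-- of those vertices without `v` fail because `v` stays white.
orderedPlusIsolated⇒span : {G : Graph (suc m)} → OrderedPlusIsolated G →
                               All (SpanCardinality G) (applyUpTo suc m)
orderedPlusIsolated⇒span {m} {G} O = All.applyUpTo⁺₁ suc m λ {i} i<m →
  let p , ∣p∣≡i = subsetOfSize (<⇒≤ i<m)
      q , ∣q∣≡1+i = subsetOfSize i<m
  in (insertAt p v inside , trans (∣insertAt∣ p v inside) (cong suc ∣p∣≡i) ,
        isolated∈⇒forcing O (∈-insertAt-inside p v))
   , (insertAt q v outside , trans (∣insertAt∣ q v outside) ∣q∣≡1+i ,
        isolated-white⇒¬forcing G isolated (∉-insertAt-outside q v))
  where open OrderedPlusIsolated O

theorem18 : ∀ (n : ℕ) → .{{_ : NonZero n}} → (G : Graph n) →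
    (λ⁻ G ≡ n ∸ 1 ⇔ (∃[ m ] Σ[ H ∈ Graph m ] (TwoSetPerfectlyOrderable H × G ≅ H ⊔ K₁)))
    × λ⁻ G ≤ n ∸ 1
theorem18 (suc m) G = mk⇔ to from , λ⁻≤ G
  where
  to : λ⁻ G ≡ m → _
  to e with v , isolated , forcing ← span⇒isolated-forces G (Equivalence.to (λ⁻≡⇔span G) e) =
    m , delete G v , chronology⇒2SPO (delete-chronology G v isolated (chronology G forcing)) ,
    delete-⊔-K₁ G v isolated

  from : _ → λ⁻ G ≡ m
  from (_ , _ , 2SPO , iso) =
    Equivalence.from (λ⁻≡⇔span G) (orderedPlusIsolated⇒span (orderedPlusIsolated 2SPO iso))
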